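{- For $k\ge 1$, $$\frac{n-k-1}{k+1}\,N_k^{n,r}=\frac{n-2k}{k}\,N_{k-1}^{n,r}+N_{k-2}^{n-1,r}+N_{k-2}^{n-1,r-1}.$$
   Context: A lattice path of length $n$ here is a path in the plane starting at the origin $(0,0)$ and consisting of $n$ unit steps, each either E $=(1,0)$ or N $=(0,1)$. Let $N_k^{n,r}$ be the number of ordered pairs of lattice paths of length $n$, both ending at $(r,n-r)$, that intersect exactly $k$ times, where intersections at the origin and at the common endpoint are not counted; that is, there are exactly $k$ indices $m$ with $1\le m\le n-1$ such that the two paths are at the same lattice point after $m$ steps.
   Formalization: The identity is proved for n ≥ 2; for n = 1 it fails as stated (n = k = 1, r = 0 gives 0 on the left and −1 on the right), and for n = 0 the terms with n−1 are undefined. -}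

module Defs where

open import Data.Fin using (Fin; zero; suc; toℕ; fromℕ)
open import Data.Integer as ℤ using (ℤ; +_)
open import Data.List using (List; []; _∷_; allFin; cartesianProduct; cartesianProductWith; filter; length)
open import Data.Nat using (ℕ; zero; suc; _≤_; _<_; _≤?_; _<?_)
open import Data.Product using (_×_; _,_)
open import Data.Product.Properties using (≡-dec)
open import Data.Vec using (Vec; []; _∷_)
open import Relation.Binary.Definitions using (DecidableEquality)
open import Relation.Binary.PropositionalEquality using (_≡_)
open import Relation.Nullary using (Dec)
open import Relation.Nullary.Decidable using (_×-dec_)

-- Integer coordinates, so that an endpoint (r , n - r) makes sense for every
-- integer r; outside 0 ≤ r ≤ n it is simply never reached.
Point : Set
Point = ℤ × ℤ

_≟ᴾ_ : DecidableEquality Point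
_≟ᴾ_ = ≡-dec ℤ._≟_ ℤ._≟_

data Step : Set where
  E N : Step

move : Step → Point → Point
move E (x , y) = (x ℤ.+ + 1 , y)
move N (x , y) = (x , y ℤ.+ + 1)

Path : ℕ → Set
Path n = Vec Step n

-- The point reached from the origin after the first m steps.  (The order in
-- which the displacements are added up is immaterial.)
position : ∀ {n} → Path n → Fin (suc n) → Point
position p       zero    = (+ 0 , + 0)
position (s ∷ p) (suc m) = move s (position p m)

endpoint : ∀ {n} → Path n → Point
endpoint {n} p = position p (fromℕ n)

InteriorMeeting : ∀ {n} → Path n → Path n → Fin (suc n) → Set
InteriorMeeting {n} p q m =
  1 ≤ toℕ m × toℕ m < n × position p m ≡ position q m

interiorMeeting? : ∀ {n} (p q : Path n) (m : Fin (suc n)) → Dec (InteriorMeeting p q m)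
interiorMeeting? {n} p q m =
  (1 ≤? toℕ m) ×-dec (toℕ m <? n) ×-dec (position p m ≟ᴾ position q m)

intersections : ∀ {n} → Path n → Path n → ℕ
intersections {n} p q = length (filter (interiorMeeting? p q) (allFin (suc n)))

-- Every path of length n, listed exactly once.
allPaths : ∀ n → List (Path n)
allPaths zero    = [] ∷ []
allPaths (suc n) = cartesianProductWith _∷_ (E ∷ N ∷ []) (allPaths n)

-- k is an integer so that N_{k-2} is meaningful (and zero) when k = 1.
Admissible : ∀ n (r k : ℤ) → Path n × Path n → Set
Admissible n r k (p , q) =
  endpoint p ≡ (r , + n ℤ.- r) ×
  endpoint q ≡ (r , + n ℤ.- r) ×
  + intersections p q ≡ k

admissible? : ∀ n r k (pq : Path n × Path n) → Dec (Admissible n r k pq)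
admissible? n r k (p , q) =
  (endpoint p ≟ᴾ (r , + n ℤ.- r)) ×-dec
  (endpoint q ≟ᴾ (r , + n ℤ.- r)) ×-dec
  (+ intersections p q ℤ.≟ k)

-- pairCount n r k is N_k^{n,r}.
pairCount : ℕ → ℤ → ℤ → ℕ
pairCount n r k =
  length (filter (admissible? n r k) (cartesianProduct (allPaths n) (allPaths n)))

{-# OPTIONS --safe #-}

-- Let P be the generating function, in x (for E) and y (for N), of the pairs of
-- paths that meet only at their two ends.  Cutting a pair at its meetings shows
-- that N_k has generating function P^(k+1), and P solves P² = 2 P - C with
-- C = 2 (x + y) - (x - y)².  Differentiating this quadratic relation yields the
-- theorem.  Series are never multiplied: P^k is a family of coefficient
-- functions satisfying P^(k+2) = 2 P^(k+1) - C P^k.  The theorem is quadratic in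
-- the index k, but its difference in k is k + 1 times a relation whose defect
-- is linear in k and satisfies the same recurrence, hence is zero.
module Submission where

open import Defs
open import Algebra.Bundles using (AbelianGroup)
open import Data.Bool using (true; false; if_then_else_)
open import Data.Fin using (Fin; zero; suc; toℕ; fromℕ)
import Data.Fin.Properties as Finₚ
open import Data.Integer as ℤ using (ℤ; +_)
import Data.Integer.Properties as ℤₚ
open import Data.Integer.Tactic.RingSolver using (solve-∀)
open import Data.List using (List; []; _∷_; _++_; map; filter; length; tabulate; cartesianProduct)
open import Data.List.Properties using (map-++; map-∘; map-tabulate; tabulate-cong; ++-identityʳ)
open import Data.Nat as ℕ using (ℕ; zero; suc; _∸_; _≤_; NonZero; z≤n; s≤s)
open import Data.Nat.Induction using (<-rec)
open import Data.Nat.ListAction using (sum)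
open import Data.Nat.ListAction.Properties using (sum-++)
import Data.Nat.Properties as ℕₚ
open import Data.Product using (_×_; _,_; proj₁; proj₂; map₂)
import Data.Rational.Properties as ℚₚ
open import Data.Rational.Unnormalised as ℚᵘ using (mkℚᵘ; *≡*)
import Data.Rational.Unnormalised.Properties as ℚᵘₚ
open import Data.Vec using ([]; _∷_)
open import Function using (_∘_; _⇔_; mk⇔; Equivalence)
open import Relation.Binary.PropositionalEquality
  using (_≡_; _≢_; refl; sym; trans; cong; cong₂; module ≡-Reasoning)
open import Relation.Nullary using (Dec; yes; no; does; ¬_)
open import Relation.Nullary.Decidable using (does-⇔; dec-true; dec-false; _×-dec_)

open import Algebra.Properties.CommutativeSemigroup ℕₚ.+-commutativeSemigroup using (interchange)
open import Algebra.Properties.Group (AbelianGroup.group ℤₚ.+-0-abelianGroup)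
  using () renaming (∙-cancelˡ to +-cancelˡ; ∙-cancelʳ to +-cancelʳ)

𝟙 : ∀ {a} {A : Set a} → Dec A → ℕ
𝟙 A? = if does A? then 1 else 0

-- Recurrences for pairs of walks and for the powers of P.

module Recurrence where
  open import Data.Integer using (_+_; _*_; _-_; -_)

  δ : ℤ → ℤ
  δ r = + 𝟙 (r ℤ.≟ + 0)

  -- walks n d k r counts the pairs of walks with n steps to go that are d apart,
  -- end together and meet k times after their first meeting (for d = 0 the
  -- current position is that first meeting); r is the number of E steps left to
  -- the walk that has fewer of them left.
  walks : ℕ → ℕ → ℕ → ℤ → ℤ
  walks zero    zero    zero    r = δ r
  walks zero    zero    (suc k) r = + 0
  walks zero    (suc d) k       r = + 0
  walks (suc n) (suc d) k       r =
    walks n (suc d) k r + walks n (suc d) k (r - + 1)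
      + walks n (suc (suc d)) k (r - + 1) + walks n d k r
  walks (suc n) zero    zero    r = + 0
  walks (suc n) zero    (suc k) r =
    walks n zero k r + walks n zero k (r - + 1) + + 2 * walks n 1 k (r - + 1)

  -- Let F be the generating function for closing a gap of one. Then gap d and k later meetings have
  -- generating function F^d P^k, and P = x + y + 2 x F by the first step out of a meeting. This is
  -- multiplication by P at an arbitrary gap, where the definition gives it only at gap 0.
  walks-suc : ∀ n d k r → walks (suc n) d (suc k) r ≡
    walks n d k r + walks n d k (r - + 1) + + 2 * walks n (suc d) k (r - + 1)
  walks-suc n       zero          k r = refl
  walks-suc zero    (suc zero)    k r = refl
  walks-suc zero    (suc (suc d)) k r = refl
  walks-suc (suc n) (suc d)       k r = trans
    (cong₂ _+_ (cong₂ _+_ (cong₂ _+_ (walks-suc n (suc d) k r) (walks-suc n (suc d) k (r - + 1)))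
                          (walks-suc n (suc (suc d)) k (r - + 1)))
               (walks-suc n d k r))
    (regroup (walks n (suc d) k r) (walks n (suc d) k (r - + 1)) (walks n (suc d) k (r - + 1 - + 1))
             (walks n (suc (suc d)) k (r - + 1)) (walks n (suc (suc d)) k (r - + 1 - + 1))
             (walks n (suc (suc (suc d))) k (r - + 1 - + 1))
             (walks n d k r) (walks n d k (r - + 1)))
    where
    regroup : ∀ x₀ x₁ x₂ y₁ y₂ z₂ t₀ t₁ →
      (x₀ + x₁ + + 2 * y₁) + (x₁ + x₂ + + 2 * y₂) + (y₁ + y₂ + + 2 * z₂) + (t₀ + t₁ + + 2 * x₁)
        ≡ (x₀ + x₁ + y₁ + t₀) + (x₁ + x₂ + y₂ + t₁) + + 2 * (y₁ + y₂ + z₂ + x₁)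
    regroup = solve-∀

  -- Every meeting after the first takes at least one step.
  walks-short : ∀ n d k r → n ℕ.< k → walks n d k r ≡ + 0
  walks-short zero    zero    (suc k) r n<k = refl
  walks-short zero    (suc d) k       r n<k = refl
  walks-short (suc n) zero    (suc k) r (s≤s n<k)
    rewrite walks-short n 0 k r n<k | walks-short n 0 k (r - + 1) n<k
          | walks-short n 1 k (r - + 1) n<k = refl
  walks-short (suc n) (suc d) k       r n<k
    rewrite walks-short n (suc d) k r (ℕₚ.<-trans (ℕₚ.n<1+n n) n<k)
          | walks-short n (suc d) k (r - + 1) (ℕₚ.<-trans (ℕₚ.n<1+n n) n<k)
          | walks-short n (suc (suc d)) k (r - + 1) (ℕₚ.<-trans (ℕₚ.n<1+n n) n<k)
          | walks-short n d k r (ℕₚ.<-trans (ℕₚ.n<1+n n) n<k) = refl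

  -- Multiplication by fixed polynomials, acting on coefficients.

  -- X n r is the coefficient of x^r y^(n-r).
  Series : Set
  Series = ℕ → ℤ → ℤ

  -- Multiplication by x + y.
  w : Series → Series
  w X zero    r = + 0
  w X (suc n) r = X n r + X n (r - + 1)

  -- Multiplication by 2 (x + y) - (x - y)².
  C : Series → Series
  C X zero          r = + 0
  C X (suc zero)    r = + 2 * (X 0 r + X 0 (r - + 1))
  C X (suc (suc n)) r = + 2 * (X (suc n) r + X (suc n) (r - + 1))
                          - (X n r - + 2 * X n (r - + 1) + X n (r - + 1 - + 1))

  -- Keeping the terms in a list lets the linearity of `w` and `C` be proved once for any number of
  -- them. The weights do not depend on n, since `w` and `C` mix degrees.
  combination : List (ℤ × Series) → Series
  combination []             n r = + 0
  combination ((c , X) ∷ xs) n r = c * X n r + combination xs n r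

  w-cong : ∀ {X Y : Series} → (∀ n r → X n r ≡ Y n r) → ∀ n r → w X n r ≡ w Y n r
  w-cong X≗Y zero    r = refl
  w-cong X≗Y (suc n) r = cong₂ _+_ (X≗Y n r) (X≗Y n (r - + 1))

  w-combination : ∀ xs n r → w (combination xs) n r ≡ combination (map (map₂ w) xs) n r
  w-combination []             zero    r = refl
  w-combination []             (suc n) r = refl
  w-combination ((c , X) ∷ xs) zero    r =
    cong₂ _+_ (sym (ℤₚ.*-zeroʳ c)) (w-combination xs zero r)
  w-combination ((c , X) ∷ xs) (suc n) r = trans
    (regroup c (X n r) (X n (r - + 1)) (combination xs n r) (combination xs n (r - + 1)))
    (cong₂ _+_ {x = c * w X (suc n) r} refl (w-combination xs (suc n) r))
    where
    regroup : ∀ c x₀ x₁ y₀ y₁ → (c * x₀ + y₀) + (c * x₁ + y₁) ≡ c * (x₀ + x₁) + (y₀ + y₁)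
    regroup = solve-∀

  C-combination : ∀ xs n r → C (combination xs) n r ≡ combination (map (map₂ C) xs) n r
  C-combination []             zero          r = refl
  C-combination []             (suc zero)    r = refl
  C-combination []             (suc (suc n)) r = refl
  C-combination ((c , X) ∷ xs) zero          r =
    cong₂ _+_ (sym (ℤₚ.*-zeroʳ c)) (C-combination xs zero r)
  C-combination ((c , X) ∷ xs) (suc zero)    r = trans
    (regroup c (X 0 r) (X 0 (r - + 1)) (combination xs 0 r) (combination xs 0 (r - + 1)))
    (cong₂ _+_ {x = c * C X 1 r} refl (C-combination xs 1 r))
    where
    regroup : ∀ c x₀ x₁ y₀ y₁ → + 2 * ((c * x₀ + y₀) + (c * x₁ + y₁))
      ≡ c * (+ 2 * (x₀ + x₁)) + + 2 * (y₀ + y₁)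
    regroup = solve-∀
  C-combination ((c , X) ∷ xs) (suc (suc n)) r = trans
    (regroup c (X (suc n) r) (X (suc n) (r - + 1))
      (X n r) (X n (r - + 1)) (X n (r - + 1 - + 1))
      (combination xs (suc n) r) (combination xs (suc n) (r - + 1))
      (combination xs n r) (combination xs n (r - + 1)) (combination xs n (r - + 1 - + 1)))
    (cong₂ _+_ {x = c * C X (suc (suc n)) r} refl (C-combination xs (suc (suc n)) r))
    where
    regroup : ∀ c x₀ x₁ x₂ x₃ x₄ y₀ y₁ y₂ y₃ y₄ →
      + 2 * ((c * x₀ + y₀) + (c * x₁ + y₁))
        - ((c * x₂ + y₂) - + 2 * (c * x₃ + y₃) + (c * x₄ + y₄))
      ≡ c * (+ 2 * (x₀ + x₁) - (x₂ - + 2 * x₃ + x₄))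
        + (+ 2 * (y₀ + y₁) - (y₂ - + 2 * y₃ + y₄))
    regroup = solve-∀

  C-w : ∀ X n r → C (w X) n r ≡ w (C X) n r
  C-w X zero                r = refl
  C-w X (suc zero)          r = refl
  C-w X (suc (suc zero))    r = regroup (X 0 r) (X 0 (r - + 1)) (X 0 (r - + 1 - + 1))
    where
    regroup : ∀ x₀ x₁ x₂ → + 2 * ((x₀ + x₁) + (x₁ + x₂)) - + 0
      ≡ + 2 * (x₀ + x₁) + + 2 * (x₁ + x₂)
    regroup = solve-∀
  C-w X (suc (suc (suc n))) r = regroup
    (X (suc n) r) (X (suc n) (r - + 1)) (X (suc n) (r - + 1 - + 1))
    (X n r) (X n (r - + 1)) (X n (r - + 1 - + 1)) (X n (r - + 1 - + 1 - + 1))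
    where
    regroup : ∀ x₀ x₁ x₂ y₀ y₁ y₂ y₃ →
      + 2 * ((x₀ + x₁) + (x₁ + x₂)) - ((y₀ + y₁) - + 2 * (y₁ + y₂) + (y₂ + y₃))
      ≡ (+ 2 * (x₀ + x₁) - (y₀ - + 2 * y₁ + y₂)) + (+ 2 * (x₁ + x₂) - (y₁ - + 2 * y₂ + y₃))
    regroup = solve-∀

  -- Multiplying by n is the Euler derivation D, and D C - C D is multiplication
  -- by D C = 2 C - 2 (x + y).
  C-degree : ∀ X Y n r → C (λ n r → + n * X n r - Y n r) n r ≡
    + n * C X n r - + 2 * C X n r + + 2 * w X n r - C Y n r
  C-degree X Y zero          r = refl
  C-degree X Y (suc zero)    r = regroup (X 0 r) (X 0 (r - + 1)) (Y 0 r) (Y 0 (r - + 1))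
    where
    regroup : ∀ x₀ x₁ y₀ y₁ → + 2 * ((+ 0 * x₀ - y₀) + (+ 0 * x₁ - y₁)) ≡
      + 1 * (+ 2 * (x₀ + x₁)) - + 2 * (+ 2 * (x₀ + x₁)) + + 2 * (x₀ + x₁) - + 2 * (y₀ + y₁)
    regroup = solve-∀
  C-degree X Y (suc (suc n)) r = regroup (+ n)
    (X (suc n) r) (X (suc n) (r - + 1)) (X n r) (X n (r - + 1)) (X n (r - + 1 - + 1))
    (Y (suc n) r) (Y (suc n) (r - + 1)) (Y n r) (Y n (r - + 1)) (Y n (r - + 1 - + 1))
    where
    regroup : ∀ n x₀ x₁ x₂ x₃ x₄ y₀ y₁ y₂ y₃ y₄ →
      + 2 * (((+ 1 + n) * x₀ - y₀) + ((+ 1 + n) * x₁ - y₁))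
        - ((n * x₂ - y₂) - + 2 * (n * x₃ - y₃) + (n * x₄ - y₄))
      ≡ (+ 2 + n) * (+ 2 * (x₀ + x₁) - (x₂ - + 2 * x₃ + x₄))
        - + 2 * (+ 2 * (x₀ + x₁) - (x₂ - + 2 * x₃ + x₄)) + + 2 * (x₀ + x₁)
        - (+ 2 * (y₀ + y₁) - (y₂ - + 2 * y₃ + y₄))
    regroup = solve-∀

  -- The polynomial behind `C` has no constant term, so degree n of the product sees only lower
  -- degrees of X. Induction on the degree rests on this.
  C-zero : ∀ X n r → (∀ m s → m ℕ.< n → X m s ≡ + 0) → C X n r ≡ + 0
  C-zero X zero          r X≗0 = refl
  C-zero X (suc zero)    r X≗0
    rewrite X≗0 0 r (s≤s z≤n) | X≗0 0 (r - + 1) (s≤s z≤n) = refl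
  C-zero X (suc (suc n)) r X≗0
    rewrite X≗0 (suc n) r ℕₚ.≤-refl | X≗0 (suc n) (r - + 1) ℕₚ.≤-refl
          | X≗0 n r (ℕₚ.m≤n⇒m≤1+n ℕₚ.≤-refl) | X≗0 n (r - + 1) (ℕₚ.m≤n⇒m≤1+n ℕₚ.≤-refl)
          | X≗0 n (r - + 1 - + 1) (ℕₚ.m≤n⇒m≤1+n ℕₚ.≤-refl) = refl

  -- The powers of P and their quadratic relation.

  P : ℕ → Series
  P k n r = walks n 0 k r

  P-rec : ∀ k n r → P (2 ℕ.+ k) n r ≡ + 2 * P (1 ℕ.+ k) n r - C (P k) n r
  P-rec k zero          r = refl
  P-rec k (suc zero)    r = regroup (P k 0 r) (P k 0 (r - + 1))
    where
    regroup : ∀ x₀ x₁ → + 0 ≡ + 2 * (x₀ + x₁ + + 0) - + 2 * (x₀ + x₁)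
    regroup = solve-∀
  P-rec k (suc (suc n)) r = trans
    -- Walks at gap 1 occur on both sides: on the left `walks-suc` removes a meeting from them, on
    -- the right the definition unfolds their first step. The results differ exactly by `C (P k)`.
    (cong (λ t → P (suc k) (suc n) r + P (suc k) (suc n) (r - + 1) + + 2 * t)
          (walks-suc n 1 k (r - + 1)))
    (regroup (P k (suc n) r) (P k (suc n) (r - + 1))
      (P k n r) (P k n (r - + 1)) (P k n (r - + 1 - + 1))
      (walks n 1 k (r - + 1)) (walks n 1 k (r - + 1 - + 1)) (walks n 2 k (r - + 1 - + 1)))
    where
    regroup : ∀ q₀ q₁ x₀ x₁ x₂ y₁ y₂ z₂ →
      (x₀ + x₁ + + 2 * y₁) + (x₁ + x₂ + + 2 * y₂) + + 2 * (y₁ + y₂ + + 2 * z₂)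
      ≡ + 2 * (q₀ + q₁ + + 2 * (y₁ + y₂ + z₂ + x₁))
        - (+ 2 * (q₀ + q₁) - (x₀ - + 2 * x₁ + x₂))
    regroup = solve-∀

  C-P : ∀ k n r → C (P k) n r ≡ + 2 * P (1 ℕ.+ k) n r - P (2 ℕ.+ k) n r
  C-P k n r rewrite P-rec k n r = regroup (P (1 ℕ.+ k) n r) (C (P k) n r)
    where
    regroup : ∀ x y → y ≡ + 2 * x - (+ 2 * x - y)
    regroup = solve-∀

  C-wP : ∀ k n r → C (w (P k)) n r ≡ + 2 * w (P (1 ℕ.+ k)) n r - w (P (2 ℕ.+ k)) n r
  C-wP k n r = begin
    C (w (P k)) n r ≡⟨ C-w (P k) n r ⟩
    w (C (P k)) n r ≡⟨ w-cong (λ m s → trans (C-P k m s) (unfold (P (1 ℕ.+ k) m s) _)) n r ⟩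
    w (combination terms) n r ≡⟨ w-combination terms n r ⟩
    combination (map (map₂ w) terms) n r ≡⟨ unfold (w (P (1 ℕ.+ k)) n r) _ ⟨
    + 2 * w (P (1 ℕ.+ k)) n r - w (P (2 ℕ.+ k)) n r ∎
    where
    open ≡-Reasoning
    terms : List (ℤ × Series)
    terms = (+ 2 , P (1 ℕ.+ k)) ∷ (- + 1 , P (2 ℕ.+ k)) ∷ []
    unfold : ∀ x y → + 2 * x - y ≡ + 2 * x + (- + 1 * y + + 0)
    unfold = solve-∀

  -- The Euler derivative of (1 - P)² P^k.

  -- (1 - P)² P^k, followed by an expression for its Euler derivative that is
  -- linear in the powers of P (at k = 0 the term with k ∸ 1 has coefficient 0).
  square : ℕ → List (ℤ × Series)
  square k = (+ 1 , P k) ∷ (- + 2 , P (1 ℕ.+ k)) ∷ (+ 1 , P (2 ℕ.+ k)) ∷ []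

  derivative : ℕ → List (ℤ × Series)
  derivative k =
    (+ 2 * + k , P k) ∷ (- (+ 3 * + k + + 4) , P (1 ℕ.+ k)) ∷ (+ k + + 2 , P (2 ℕ.+ k)) ∷
    (+ k + + 2 , w (P k)) ∷ (- + k , w (P (k ∸ 1))) ∷ []

  -- Differentiating P² = 2 P - C gives (1 - P) DP = C - (x + y). By the product rule, D((1 - P)²
  -- P^k) = (C - (x + y)) (k P^(k-1) - (k + 2) P^k), and C = 2 P - P² turns this into
  -- `derivative k`. So the difference is expected to vanish.
  defect : ℕ → Series
  defect k n r = + n * combination (square k) n r - combination (derivative k) n r

  -- At k = 0 truncated subtraction yields `P 0` where P^(-1) is meant, and `C-wP` does not apply;
  -- the coefficient 0 makes both sides vanish.
  k*C-wP : ∀ k n r → - + k * C (w (P (k ∸ 1))) n r ≡ - + k * (+ 2 * w (P k) n r - w (P (1 ℕ.+ k)) n r)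
  k*C-wP zero    n r = refl
  k*C-wP (suc k) n r = cong (- + suc k *_) (C-wP k n r)

  -- Two effects disturb the recurrence of the powers of P: the coefficients are linear in k, and
  -- multiplication by n does not commute with `C`. Their contributions cancel once every product
  -- with C is rewritten in powers of P.
  defect-rec : ∀ k n r → defect (2 ℕ.+ k) n r ≡ + 2 * defect (1 ℕ.+ k) n r - C (defect k) n r
  defect-rec k n r
    rewrite C-degree (combination (square k)) (combination (derivative k)) n r
          | C-combination (square k) n r | C-combination (derivative k) n r | w-combination (square k) n r
          | C-P k n r | C-P (1 ℕ.+ k) n r | C-P (2 ℕ.+ k) n r | C-wP k n r
          | k*C-wP k n r
    = regroup (+ n) (+ k) (P k n r) (P (1 ℕ.+ k) n r) (P (2 ℕ.+ k) n r) (P (3 ℕ.+ k) n r) (P (4 ℕ.+ k) n r)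
        (w (P k) n r) (w (P (1 ℕ.+ k)) n r) (w (P (2 ℕ.+ k)) n r)
    where
    regroup : ∀ n k p₀ p₁ p₂ p₃ p₄ w₀ w₁ w₂ →
      n * (+ 1 * p₂ + (- + 2 * p₃ + (+ 1 * p₄ + + 0)))
        - (+ 2 * (+ 2 + k) * p₂ + (- (+ 3 * (+ 2 + k) + + 4) * p₃ + ((+ 2 + k + + 2) * p₄
            + ((+ 2 + k + + 2) * w₂ + (- (+ 2 + k) * w₁ + + 0)))))
      ≡ + 2 * (n * (+ 1 * p₁ + (- + 2 * p₂ + (+ 1 * p₃ + + 0)))
        - (+ 2 * (+ 1 + k) * p₁ + (- (+ 3 * (+ 1 + k) + + 4) * p₂ + ((+ 1 + k + + 2) * p₃
            + ((+ 1 + k + + 2) * w₁ + (- (+ 1 + k) * w₀ + + 0))))))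
        - (n * (+ 1 * (+ 2 * p₁ - p₂) + (- + 2 * (+ 2 * p₂ - p₃) + (+ 1 * (+ 2 * p₃ - p₄) + + 0)))
          - + 2 * (+ 1 * (+ 2 * p₁ - p₂) + (- + 2 * (+ 2 * p₂ - p₃) + (+ 1 * (+ 2 * p₃ - p₄) + + 0)))
          + + 2 * (+ 1 * w₀ + (- + 2 * w₁ + (+ 1 * w₂ + + 0)))
          - (+ 2 * k * (+ 2 * p₁ - p₂) + (- (+ 3 * k + + 4) * (+ 2 * p₂ - p₃) + ((k + + 2) * (+ 2 * p₃ - p₄)
            + ((k + + 2) * (+ 2 * w₁ - w₂) + (- k * (+ 2 * w₀ - w₁) + + 0))))))
    regroup = solve-∀

  -- Here (1 - P)² = 1 - C is a polynomial of degree 2, so degrees 0, 1 and 2 are computed, and in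
  -- higher degrees P² and 2 P have equal coefficients.
  defect-zero : ∀ n r → defect 0 n r ≡ + 0
  defect-zero zero                r = refl
  defect-zero (suc zero)          r = cancel (δ r) (δ (r - + 1))
    where
    cancel : ∀ x y →
      + 1 * (+ 1 * + 0 + (- + 2 * (x + y + + 0) + + 0))
        - (+ 0 + (- + 4 * (x + y + + 0) + (+ 0 + (+ 2 * (x + y) + + 0)))) ≡ + 0
    cancel = solve-∀
  defect-zero (suc (suc zero))    r = cancel (P 1 2 r) (P 2 2 r)
    where
    cancel : ∀ x y →
      + 2 * (+ 0 + (- + 2 * x + (+ 1 * y + + 0))) - (+ 0 + (- + 4 * x + (+ 2 * y + + 0))) ≡ + 0
    cancel = solve-∀
  defect-zero (suc (suc (suc n))) r = trans
    (cong (λ y → (+ 3 + + n) * (+ 0 + (- + 2 * P 1 (3 ℕ.+ n) r + (+ 1 * y + + 0)))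
                   - (+ 0 + (- + 4 * P 1 (3 ℕ.+ n) r + (+ 2 * y + + 0))))
          (P-rec 0 (3 ℕ.+ n) r))
    (cancel (+ n) (P 1 (3 ℕ.+ n) r))
    where
    cancel : ∀ n x →
      (+ 3 + n) * (+ 0 + (- + 2 * x + (+ 1 * (+ 2 * x - + 0) + + 0)))
        - (+ 0 + (- + 4 * x + (+ 2 * (+ 2 * x - + 0) + + 0))) ≡ + 0
    cancel = solve-∀

  -- Multiplication by x + y raises the degree by one, so n = k is included.
  w-short : ∀ k n r → n ℕ.≤ k → w (P k) n r ≡ + 0
  w-short k zero    r n≤k = refl
  w-short k (suc n) r n<k = cong₂ _+_ (walks-short n 0 k r n<k) (walks-short n 0 k (r - + 1) n<k)

  defect-short : ∀ k n r → n ℕ.< k → defect k n r ≡ + 0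
  defect-short (suc k) n r (s≤s n≤k)
    rewrite walks-short n 0 (1 ℕ.+ k) r (s≤s n≤k)
          | walks-short n 0 (2 ℕ.+ k) r (ℕₚ.m≤n⇒m≤1+n (s≤s n≤k))
          | walks-short n 0 (3 ℕ.+ k) r (ℕₚ.m≤n⇒m≤1+n (ℕₚ.m≤n⇒m≤1+n (s≤s n≤k)))
          | w-short (1 ℕ.+ k) n r (ℕₚ.m≤n⇒m≤1+n n≤k) | w-short k n r n≤k
    = cancel (+ n) (+ k)
    where
    cancel : ∀ n k → n * + 0 - (+ 2 * (+ 1 + k) * + 0 + (- (+ 3 * (+ 1 + k) + + 4) * + 0
      + ((+ 1 + k + + 2) * + 0 + ((+ 1 + k + + 2) * + 0 + (- (+ 1 + k) * + 0 + + 0))))) ≡ + 0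
    cancel = solve-∀

  -- Solve the recurrence for its middle term: induct on n, and downwards on k
  -- from k > n, where everything vanishes.
  defect≡0 : ∀ n k r → defect k n r ≡ + 0
  defect≡0 = <-rec _ λ n below → descend n (λ m s m<n k → below m<n k s)
    where
    descend : ∀ n → (∀ m s → m ℕ.< n → ∀ k → defect k m s ≡ + 0) → ∀ k r → defect k n r ≡ + 0
    descend n below k r = go (suc n) k (ℕₚ.m≤n+m (suc n) k)
      where
      -- The fuel g bounds how far k is from the range k > n; it drops by one as the index rises by
      -- one.
      go : ∀ g k → n ℕ.< k ℕ.+ g → defect k n r ≡ + 0
      go zero    k       n<k+g = defect-short k n r (ℕₚ.<-≤-trans n<k+g (ℕₚ.≤-reflexive (ℕₚ.+-identityʳ k)))
      -- Index 0 is never the middle term of the recurrence.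
      go (suc g) zero    n<k+g = defect-zero n r
      -- The term at `2 + k` has less fuel, and `defect k` enters only through `C`, that is, in
      -- degrees below n.
      go (suc g) (suc k) n<k+g = ℤₚ.*-cancelˡ-≡ (+ 2) _ _
        (halve (trans (sym (defect-rec k n r)) (go g (2 ℕ.+ k) (ℕₚ.<-≤-trans n<k+g (ℕₚ.≤-reflexive (ℕₚ.+-suc (suc k) g)))))
               (C-zero (defect k) n r (λ m s m<n → below m s m<n k)))
        where
        halve : ∀ {x y} → + 2 * x - y ≡ + 0 → y ≡ + 0 → + 2 * x ≡ + 2 * + 0
        halve {x} eq refl = trans (sym (ℤₚ.+-identityʳ (+ 2 * x))) eq

  -- The theorem times k (k + 1), with P^(k+1) for N_k. In this form it also makes sense at k = 0,
  -- where the induction starts.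
  relationDefect : ℕ → Series
  relationDefect k n r = + k * (+ n - + k - + 1) * P (1 ℕ.+ k) n r
    - (+ k + + 1) * (+ n - + 2 * + k) * P k n r - + k * (+ k + + 1) * w (P (k ∸ 1)) n r

  relationDefect≡0 : ∀ k n r → relationDefect k n r ≡ + 0
  -- Only n P^0 is left: P^0 = 1 has no coefficient in positive degree, and in degree 0 the factor n
  -- is 0.
  relationDefect≡0 zero zero    r = cancel (δ r)
    where
    cancel : ∀ x → + 0 - + 0 * x - + 0 ≡ + 0
    cancel = solve-∀
  relationDefect≡0 zero (suc n) r = cancel (+ n)
    where
    cancel : ∀ n → + 0 - + 1 * (+ 1 + n - + 0) * + 0 - + 0 ≡ + 0
    cancel = solve-∀
  relationDefect≡0 (suc k) n r = trans
    (step (+ n) (+ k) (P k n r) (P (1 ℕ.+ k) n r) (P (2 ℕ.+ k) n r) (w (P k) n r) (w (P (k ∸ 1)) n r))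
    (trans (cong₂ (λ t d → t + (+ k + + 1) * d) (relationDefect≡0 k n r) (defect≡0 n k r))
           (cong (λ d → + 0 + d) (ℤₚ.*-zeroʳ (+ k + + 1))))
    where
    step : ∀ n k p₀ p₁ p₂ w₀ w₋ →
      (+ 1 + k) * (n - (+ 1 + k) - + 1) * p₂ - (+ 1 + k + + 1) * (n - + 2 * (+ 1 + k)) * p₁
        - (+ 1 + k) * (+ 1 + k + + 1) * w₀
      ≡ (k * (n - k - + 1) * p₁ - (k + + 1) * (n - + 2 * k) * p₀ - k * (k + + 1) * w₋)
        + (k + + 1) * (n * (+ 1 * p₀ + (- + 2 * p₁ + (+ 1 * p₂ + + 0)))
          - (+ 2 * k * p₀ + (- (+ 3 * k + + 4) * p₁ + ((k + + 2) * p₂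
            + ((k + + 2) * w₀ + (- k * w₋ + + 0))))))
    step = solve-∀

-- Indicators, and sums over pairs of paths.

𝟙-cong : ∀ {a b} {A : Set a} {B : Set b} → A ⇔ B → (A? : Dec A) (B? : Dec B) → 𝟙 A? ≡ 𝟙 B?
𝟙-cong A⇔B A? B? = cong (if_then 1 else 0) (does-⇔ A⇔B A? B?)

𝟙-true : ∀ {a} {A : Set a} (A? : Dec A) → A → 𝟙 A? ≡ 1
𝟙-true A? x = cong (if_then 1 else 0) (dec-true A? x)

𝟙-false : ∀ {a} {A : Set a} (A? : Dec A) → ¬ A → 𝟙 A? ≡ 0
𝟙-false A? ¬x = cong (if_then 1 else 0) (dec-false A? ¬x)

module _ {a} {A : Set a} where
  length-filter-sum : ∀ {p} {P : A → Set p} (P? : ∀ x → Dec (P x)) xs →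
    length (filter P? xs) ≡ sum (map (𝟙 ∘ P?) xs)
  length-filter-sum P? []       = refl
  length-filter-sum P? (x ∷ xs) with does (P? x)
  ... | true  = cong suc (length-filter-sum P? xs)
  ... | false = length-filter-sum P? xs

  sum-map-++ : ∀ (f : A → ℕ) xs ys → sum (map f (xs ++ ys)) ≡ sum (map f xs) ℕ.+ sum (map f ys)
  sum-map-++ f xs ys = trans (cong sum (map-++ f xs ys)) (sum-++ (map f xs) (map f ys))

  sum-map-× : ∀ {b} {B : Set b} (f : A × B → ℕ) xs ys →
    sum (map f (cartesianProduct xs ys)) ≡ sum (map (λ x → sum (map (λ y → f (x , y)) ys)) xs)
  sum-map-× f []       ys = refl
  sum-map-× f (x ∷ xs) ys = trans
    (trans (cong sum (map-++ f (map (x ,_) ys) (cartesianProduct xs ys)))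
           (sum-++ (map f (map (x ,_) ys)) _))
    (cong₂ ℕ._+_ (cong sum (sym (map-∘ ys))) (sum-map-× f xs ys))

-- Recursion on the first step, in place of the list `allPaths`, makes splitting by that step hold
-- by computation.
Σpath : ∀ n → (Path n → ℕ) → ℕ
Σpath zero    f = f []
Σpath (suc n) f = Σpath n (f ∘ (E ∷_)) ℕ.+ Σpath n (f ∘ (N ∷_))

Σpath-cong : ∀ n {f g : Path n → ℕ} → (∀ p → f p ≡ g p) → Σpath n f ≡ Σpath n g
Σpath-cong zero    f≗g = f≗g []
Σpath-cong (suc n) f≗g = cong₂ ℕ._+_ (Σpath-cong n (f≗g ∘ (E ∷_))) (Σpath-cong n (f≗g ∘ (N ∷_)))

Σpath-+ : ∀ n (f g : Path n → ℕ) → Σpath n (λ p → f p ℕ.+ g p) ≡ Σpath n f ℕ.+ Σpath n g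
Σpath-+ zero    f g = refl
Σpath-+ (suc n) f g = trans
  (cong₂ ℕ._+_ (Σpath-+ n (f ∘ (E ∷_)) (g ∘ (E ∷_))) (Σpath-+ n (f ∘ (N ∷_)) (g ∘ (N ∷_))))
  (interchange (Σpath n (f ∘ (E ∷_))) _ _ _)

Σpath-zero : ∀ n → Σpath n (λ _ → 0) ≡ 0
Σpath-zero zero    = refl
Σpath-zero (suc n) = cong₂ ℕ._+_ (Σpath-zero n) (Σpath-zero n)

sum-allPaths : ∀ n (f : Path n → ℕ) → sum (map f (allPaths n)) ≡ Σpath n f
sum-allPaths zero    f = ℕₚ.+-identityʳ (f [])
sum-allPaths (suc n) f = trans (sum-map-++ f (map (E ∷_) (allPaths n)) _)
  (cong₂ ℕ._+_ (half E) (trans (cong (sum ∘ map f) (++-identityʳ (map (N ∷_) (allPaths n)))) (half N)))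
  where
  half : ∀ s → sum (map f (map (s ∷_) (allPaths n))) ≡ Σpath n (f ∘ (s ∷_))
  half s = trans (cong sum (sym (map-∘ (allPaths n)))) (sum-allPaths n (f ∘ (s ∷_)))

Σpair : ∀ n → (Path n → Path n → ℕ) → ℕ
Σpair n f = Σpath n (λ p → Σpath n (f p))

Σpair-cong : ∀ n {f g : Path n → Path n → ℕ} → (∀ p q → f p q ≡ g p q) → Σpair n f ≡ Σpair n g
Σpair-cong n f≗g = Σpath-cong n λ p → Σpath-cong n (f≗g p)

Σpair-zero : ∀ n {f : Path n → Path n → ℕ} → (∀ p q → f p q ≡ 0) → Σpair n f ≡ 0
Σpair-zero n f≗0 = trans (Σpair-cong n f≗0) (trans (Σpath-cong n λ p → Σpath-zero n) (Σpath-zero n))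

Σpair-suc : ∀ n (f : Path (suc n) → Path (suc n) → ℕ) → Σpair (suc n) f ≡
  (Σpair n (λ p q → f (E ∷ p) (E ∷ q)) ℕ.+ Σpair n (λ p q → f (E ∷ p) (N ∷ q))) ℕ.+
  (Σpair n (λ p q → f (N ∷ p) (E ∷ q)) ℕ.+ Σpair n (λ p q → f (N ∷ p) (N ∷ q)))
Σpair-suc n f = cong₂ ℕ._+_ (Σpath-+ n _ _) (Σpath-+ n _ _)

pairCount-Σpair : ∀ n r k → pairCount n r k ≡ Σpair n (λ p q → 𝟙 (admissible? n r k (p , q)))
pairCount-Σpair n r k = begin
  pairCount n r k
    ≡⟨ length-filter-sum (admissible? n r k) (cartesianProduct (allPaths n) (allPaths n)) ⟩
  sum (map (𝟙 ∘ admissible? n r k) (cartesianProduct (allPaths n) (allPaths n)))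
    ≡⟨ sum-map-× (𝟙 ∘ admissible? n r k) (allPaths n) (allPaths n) ⟩
  sum (map (λ p → sum (map (λ q → 𝟙 (admissible? n r k (p , q))) (allPaths n))) (allPaths n))
    ≡⟨ sum-allPaths n _ ⟩
  Σpath n (λ p → sum (map (λ q → 𝟙 (admissible? n r k (p , q))) (allPaths n)))
    ≡⟨ Σpath-cong n (λ p → sum-allPaths n _) ⟩
  Σpair n (λ p q → 𝟙 (admissible? n r k (p , q))) ∎
  where open ≡-Reasoning

-- Counting meetings through the E steps still to be made.

abscissa : ∀ {n} → Path n → Fin (suc n) → ℤ
abscissa p i = proj₁ (position p i)

width : ∀ {n} → Path n → ℤ
width p = proj₁ (endpoint p)

-- a and b below are the numbers of E steps still to be made, so that two paths
-- that are to end together are at the same point exactly when a ≡ b.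
spend : Step → ℤ → ℤ
spend E a = a ℤ.- + 1
spend N a = a

width-∷ : ∀ {n} s (p : Path n) a → width (s ∷ p) ≡ a ⇔ width p ≡ spend s a
width-∷ N p a = mk⇔ (λ eq → eq) (λ eq → eq)
width-∷ E p a = mk⇔ (λ { refl → add-sub (width p) }) (λ eq → trans (cong (ℤ._+ + 1) eq) (sub-add a))
  where
  add-sub : ∀ x → x ≡ x ℤ.+ + 1 ℤ.- + 1
  add-sub = solve-∀
  sub-add : ∀ x → x ℤ.- + 1 ℤ.+ + 1 ≡ x
  sub-add = solve-∀

-- Start and end are both counted, so that no index needs special treatment in the recursion.
arrivals : ∀ {n} → ℤ → ℤ → Path n → Path n → ℕ
arrivals a b []      []      = 𝟙 (a ℤ.≟ b)
arrivals a b (s ∷ p) (t ∷ q) = 𝟙 (a ℤ.≟ b) ℕ.+ arrivals (spend s a) (spend t b) p q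

Meeting : ∀ {n} → ℕ → ℤ → ℤ → Path n → Path n → Set
Meeting k a b p q = width p ≡ a × width q ≡ b × arrivals a b p q ≡ k

meeting? : ∀ {n} k a b (p q : Path n) → Dec (Meeting k a b p q)
meeting? k a b p q = (width p ℤ.≟ a) ×-dec (width q ℤ.≟ b) ×-dec (arrivals a b p q ℕ.≟ k)

meetings : ℕ → ℕ → ℤ → ℤ → ℕ
meetings k n a b = Σpair n (λ p q → 𝟙 (meeting? k a b p q))

-- At the end neither path has an E step left, so the end itself is a meeting.
¬meeting-zero : ∀ {n} a b (p q : Path n) → ¬ Meeting 0 a b p q
¬meeting-zero a b []      []      (refl , refl , ())
¬meeting-zero a b (s ∷ p) (t ∷ q) (wp , wq , none) = ¬meeting-zero (spend s a) (spend t b) p q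
  ( Equivalence.to (width-∷ s p a) wp , Equivalence.to (width-∷ t q b) wq
  , ℕₚ.m+n≡0⇒n≡0 (𝟙 (a ℤ.≟ b)) none )

meetings-zero : ∀ n a b → meetings 0 n a b ≡ 0
meetings-zero n a b = Σpair-zero n λ p q → 𝟙-false (meeting? 0 a b p q) (¬meeting-zero a b p q)

-- The hypothesis isolates the contribution of the current position: l = k if the paths are apart, k
-- = l + 1 if they are together.
meetings-step : ∀ k l n a b →
  (∀ m → 𝟙 (a ℤ.≟ b) ℕ.+ m ≡ k ⇔ m ≡ l) →
  meetings k (suc n) a b ≡
    (meetings l n (a ℤ.- + 1) (b ℤ.- + 1) ℕ.+ meetings l n (a ℤ.- + 1) b) ℕ.+
    (meetings l n a (b ℤ.- + 1) ℕ.+ meetings l n a b)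
meetings-step k l n a b shift = trans (Σpair-suc n (λ p q → 𝟙 (meeting? k a b p q)))
  (cong₂ ℕ._+_ (cong₂ ℕ._+_ (step E E) (step E N)) (cong₂ ℕ._+_ (step N E) (step N N)))
  where
  step : ∀ s t → Σpair n (λ p q → 𝟙 (meeting? k a b (s ∷ p) (t ∷ q))) ≡
                 meetings l n (spend s a) (spend t b)
  step s t = Σpair-cong n λ p q → 𝟙-cong
    (mk⇔ (λ (wp , wq , m) → Equivalence.to (width-∷ s p a) wp , Equivalence.to (width-∷ t q b) wq
                              , Equivalence.to (shift _) m)
          (λ (wp , wq , m) → Equivalence.from (width-∷ s p a) wp , Equivalence.from (width-∷ t q b) wq
                              , Equivalence.from (shift _) m))
    (meeting? k a b (s ∷ p) (t ∷ q)) (meeting? l (spend s a) (spend t b) p q)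

meetings-apart : ∀ k n {a b} → a ≢ b → meetings k (suc n) a b ≡
    (meetings k n (a ℤ.- + 1) (b ℤ.- + 1) ℕ.+ meetings k n (a ℤ.- + 1) b) ℕ.+
    (meetings k n a (b ℤ.- + 1) ℕ.+ meetings k n a b)
meetings-apart k n {a} {b} a≢b = meetings-step k k n a b shift
  where
  shift : ∀ m → 𝟙 (a ℤ.≟ b) ℕ.+ m ≡ k ⇔ m ≡ k
  shift m rewrite 𝟙-false (a ℤ.≟ b) a≢b = mk⇔ (λ eq → eq) (λ eq → eq)

meetings-diagonal : ∀ k n a → meetings (suc k) (suc n) a a ≡
    (meetings k n (a ℤ.- + 1) (a ℤ.- + 1) ℕ.+ meetings k n (a ℤ.- + 1) a) ℕ.+
    (meetings k n a (a ℤ.- + 1) ℕ.+ meetings k n a a)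
meetings-diagonal k n a = meetings-step (suc k) k n a a shift
  where
  shift : ∀ m → 𝟙 (a ℤ.≟ a) ℕ.+ m ≡ suc k ⇔ m ≡ k
  shift m rewrite 𝟙-true (a ℤ.≟ a) refl = mk⇔ ℕₚ.suc-injective (cong suc)

-- By induction on n instead of exchanging the sums: off the diagonal, swapping the paths permutes
-- the four first-step terms.
meetings-comm : ∀ k n a b → meetings k n a b ≡ meetings k n b a
meetings-comm k       zero    a b = 𝟙-cong (mk⇔ flip flip) (meeting? k a b [] []) (meeting? k b a [] [])
  where
  flip : ∀ {k a b} → Meeting k a b [] [] → Meeting k b a [] []
  flip (refl , refl , m) = refl , refl , m
meetings-comm zero    (suc n) a b = trans (meetings-zero (suc n) a b) (sym (meetings-zero (suc n) b a))
meetings-comm (suc k) (suc n) a b = by-cases (a ℤ.≟ b)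
  where
  open ≡-Reasoning
  a' b' : ℤ
  a' = a ℤ.- + 1
  b' = b ℤ.- + 1
  M : ℤ → ℤ → ℕ
  M = meetings (suc k) n
  by-cases : Dec (a ≡ b) → meetings (suc k) (suc n) a b ≡ meetings (suc k) (suc n) b a
  by-cases (yes a≡b) = cong₂ (meetings (suc k) (suc n)) a≡b (sym a≡b)
  by-cases (no  a≢b) = begin
    meetings (suc k) (suc n) a b
      ≡⟨ meetings-apart (suc k) n a≢b ⟩
    (M a' b' ℕ.+ M a' b) ℕ.+ (M a b' ℕ.+ M a b)
      ≡⟨ cong₂ ℕ._+_ (cong₂ ℕ._+_ (meetings-comm (suc k) n a' b') (meetings-comm (suc k) n a' b))
                     (cong₂ ℕ._+_ (meetings-comm (suc k) n a b') (meetings-comm (suc k) n a b)) ⟩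
    (M b' a' ℕ.+ M b a') ℕ.+ (M b' a ℕ.+ M b a)
      ≡⟨ interchange (M b' a') _ _ _ ⟩
    (M b' a' ℕ.+ M b' a) ℕ.+ (M b a' ℕ.+ M b a)
      ≡⟨ sym (meetings-apart (suc k) n (a≢b ∘ sym)) ⟩
    meetings (suc k) (suc n) b a ∎

-- Meetings of paths as walks with a gap.

module _ where
  open Recurrence
  open import Data.Integer using (_+_; _*_; _-_)

  apart : ∀ a d → a ≢ a + + suc d
  apart a d eq with +-cancelˡ a (+ 0) (+ suc d) (trans (ℤₚ.+-identityʳ a) eq)
  ... | ()

  -- The index is `suc k` because `walks` leaves the first meeting uncounted; a is the smaller
  -- number of remaining E steps.
  meetings-walks : ∀ n d k a b → b ≡ a + + d → + meetings (suc k) n a b ≡ walks n d k a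
  meetings-walks zero zero zero a b b≡a+d rewrite b≡a+d | ℤₚ.+-identityʳ a = cong +_
    (𝟙-cong (mk⇔ (λ (eq , _) → sym eq) (λ eq → sym eq , sym eq , 𝟙-true (a ℤ.≟ a) refl))
      (meeting? 1 a a [] []) (a ℤ.≟ + 0))
  meetings-walks zero zero (suc k) a b b≡a+d = cong +_
    (𝟙-false (meeting? (2 ℕ.+ k) a b [] []) λ { (refl , refl , ()) })
  meetings-walks zero (suc d) k a b b≡a+d = cong +_
    (𝟙-false (meeting? (suc k) a b [] [])
      λ { (refl , refl , _) → apart (+ 0) d b≡a+d })
  meetings-walks (suc n) (suc d) k a .(a + + suc d) refl = trans
    (cong +_ (meetings-apart (suc k) n (apart a d)))
    (trans (cong₂ _+_
             (cong₂ _+_ (meetings-walks n (suc d) k (a - + 1) _ (both a (+ suc d)))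
                        (meetings-walks n (2 ℕ.+ d) k (a - + 1) _ (up a (+ suc d))))
             (cong₂ _+_ (meetings-walks n d k a _ (down a (+ d)))
                        (meetings-walks n (suc d) k a _ refl)))
           (reorder (walks n (suc d) k (a - + 1)) (walks n (2 ℕ.+ d) k (a - + 1)) (walks n d k a) (walks n (suc d) k a)))
    where
    both : ∀ a d → a + d - + 1 ≡ a - + 1 + d
    both = solve-∀
    up : ∀ a d → a + d ≡ a - + 1 + (+ 1 + d)
    up = solve-∀
    down : ∀ a d → a + (+ 1 + d) - + 1 ≡ a + d
    down = solve-∀
    reorder : ∀ x y z t → (x + y) + (z + t) ≡ t + x + y + z
    reorder = solve-∀
  meetings-walks (suc n) zero k a b b≡a+d rewrite b≡a+d | ℤₚ.+-identityʳ a = diagonal k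
    where
    lower : ∀ a → a ≡ a - + 1 + + 1
    lower = solve-∀
    regroup : ∀ x y t → (x + y) + (y + t) ≡ t + x + + 2 * y
    regroup = solve-∀
    diagonal : ∀ k → + meetings (suc k) (suc n) a a ≡ walks (suc n) 0 k a
    -- The current meeting would be the only one, yet the end is another.
    diagonal zero    = trans (cong +_ (meetings-diagonal 0 n a))
      (cong +_ (cong₂ ℕ._+_ (cong₂ ℕ._+_ (meetings-zero n _ _) (meetings-zero n _ _))
                            (cong₂ ℕ._+_ (meetings-zero n _ _) (meetings-zero n _ _))))
    diagonal (suc k) = trans (cong +_ (meetings-diagonal (suc k) n a))
      (trans (cong₂ _+_
               (cong₂ _+_ (meetings-walks n 0 k (a - + 1) _ (sym (ℤₚ.+-identityʳ (a - + 1))))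
                          (meetings-walks n 1 k (a - + 1) a (lower a)))
               -- By symmetry the two ways of separating count equally, whence the factor 2 in
               -- `walks`.
               (cong₂ _+_ (trans (cong +_ (meetings-comm (suc k) n a (a - + 1)))
                                 (meetings-walks n 1 k (a - + 1) a (lower a)))
                          (meetings-walks n 0 k a a (sym (ℤₚ.+-identityʳ a)))))
             (regroup (walks n 0 k (a - + 1)) (walks n 1 k (a - + 1)) (walks n 0 k a)))

-- From meetings to interior intersections.

cost : Step → ℤ
cost E = + 1
cost N = + 0

abscissa-∷ : ∀ {n} s (p : Path n) i → abscissa (s ∷ p) (suc i) ≡ abscissa p i ℤ.+ cost s
abscissa-∷ E p i = refl
abscissa-∷ N p i = sym (ℤₚ.+-identityʳ (abscissa p i))

spend-cost : ∀ s a → spend s a ≡ a ℤ.- cost s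
spend-cost E a = refl
spend-cost N a = sym (ℤₚ.+-identityʳ a)

-- After i steps the remaining E counts are a and b less the abscissas reached; their equality is
-- stated without subtraction.
arrivals-positions : ∀ {n} a b (p q : Path n) → arrivals a b p q ≡
  sum (tabulate λ i → 𝟙 (b ℤ.+ abscissa p i ℤ.≟ a ℤ.+ abscissa q i))
arrivals-positions a b p q = by-steps p q
  where
  start : 𝟙 (a ℤ.≟ b) ≡ 𝟙 (b ℤ.+ + 0 ℤ.≟ a ℤ.+ + 0)
  start rewrite ℤₚ.+-identityʳ a | ℤₚ.+-identityʳ b = 𝟙-cong (mk⇔ sym sym) (a ℤ.≟ b) (b ℤ.≟ a)
  shift : ∀ c d x y → (b ℤ.- d) ℤ.+ x ≡ (a ℤ.- c) ℤ.+ y ⇔ b ℤ.+ (x ℤ.+ c) ≡ a ℤ.+ (y ℤ.+ d)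
  shift c d x y = mk⇔
    (λ eq → trans (sym (move₁ b d x c)) (trans (cong (ℤ._+ (c ℤ.+ d)) eq) (move₂ a c y d)))
    (λ eq → +-cancelʳ (c ℤ.+ d) _ _ (trans (move₁ b d x c) (trans eq (sym (move₂ a c y d)))))
    where
    move₁ : ∀ b d x c → b ℤ.- d ℤ.+ x ℤ.+ (c ℤ.+ d) ≡ b ℤ.+ (x ℤ.+ c)
    move₁ = solve-∀
    move₂ : ∀ a c y d → a ℤ.- c ℤ.+ y ℤ.+ (c ℤ.+ d) ≡ a ℤ.+ (y ℤ.+ d)
    move₂ = solve-∀
  by-steps : ∀ {n} (p q : Path n) → arrivals a b p q ≡
    sum (tabulate λ i → 𝟙 (b ℤ.+ abscissa p i ℤ.≟ a ℤ.+ abscissa q i))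
  by-steps []      []      = trans start (sym (ℕₚ.+-identityʳ _))
  by-steps (s ∷ p) (t ∷ q) = cong₂ ℕ._+_ start
    (trans (arrivals-positions (spend s a) (spend t b) p q) (cong sum (tabulate-cong later)))
    where
    later : ∀ i → 𝟙 (spend t b ℤ.+ abscissa p i ℤ.≟ spend s a ℤ.+ abscissa q i) ≡
                  𝟙 (b ℤ.+ abscissa (s ∷ p) (suc i) ℤ.≟ a ℤ.+ abscissa (t ∷ q) (suc i))
    later i rewrite spend-cost s a | spend-cost t b | abscissa-∷ s p i | abscissa-∷ t q i =
      𝟙-cong (shift (cost s) (cost t) (abscissa p i) (abscissa q i)) (_ ℤ.≟ _) (_ ℤ.≟ _)

-- After i steps a path is on the line x + y = i, so abscissas alone decide meetings.
ordinate : ∀ {n} (p : Path n) i → proj₂ (position p i) ≡ + toℕ i ℤ.- abscissa p i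
ordinate p       zero    = refl
ordinate (E ∷ p) (suc i) = trans (ordinate p i) (east (+ toℕ i) (abscissa p i))
  where
  east : ∀ m x → m ℤ.- x ≡ + 1 ℤ.+ m ℤ.- (x ℤ.+ + 1)
  east = solve-∀
ordinate (N ∷ p) (suc i) = trans (cong (ℤ._+ + 1) (ordinate p i)) (north (+ toℕ i) (abscissa p i))
  where
  north : ∀ m x → m ℤ.- x ℤ.+ + 1 ≡ + 1 ℤ.+ m ℤ.- x
  north = solve-∀

abscissa⇒position : ∀ {n} (p q : Path n) i → abscissa p i ≡ abscissa q i → position p i ≡ position q i
abscissa⇒position p q i eq =
  cong₂ _,_ eq (trans (ordinate p i) (trans (cong (λ x → + toℕ i ℤ.- x) eq) (sym (ordinate q i))))

width⇔endpoint : ∀ {n} (p : Path n) r → width p ≡ r ⇔ endpoint p ≡ (r , + n ℤ.- r)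
width⇔endpoint {n} p r = mk⇔
  (λ { refl → cong (width p ,_) (trans (ordinate p (fromℕ n)) (cong (λ m → + m ℤ.- width p) (Finₚ.toℕ-fromℕ n))) })
  (cong proj₁)

sum-tabulate-last : ∀ n (f g : Fin (suc n) → ℕ) → (∀ i → toℕ i ℕ.< n → f i ≡ g i) →
  f (fromℕ n) ≡ suc (g (fromℕ n)) → sum (tabulate f) ≡ suc (sum (tabulate g))
sum-tabulate-last zero    f g init last = cong (ℕ._+ 0) last
sum-tabulate-last (suc n) f g init last = trans
  (cong₂ ℕ._+_ (init zero (s≤s z≤n))
    (sum-tabulate-last n (f ∘ suc) (g ∘ suc) (λ i i<n → init (suc i) (s≤s i<n)) last))
  (ℕₚ.+-suc (g zero) _)

-- The 2 stands for the origin and the common endpoint, which are different indices as the length is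
-- positive.
arrivals-intersections : ∀ {n} r (p q : Path (suc n)) → width p ≡ width q →
  arrivals r r p q ≡ 2 ℕ.+ intersections p q
arrivals-intersections {n} r p q wp≡wq = begin
  arrivals r r p q
    ≡⟨ arrivals-positions r r p q ⟩
  𝟙 (r ℤ.+ + 0 ℤ.≟ r ℤ.+ + 0) ℕ.+ sum (tabulate (λ i → 𝟙 (common? (suc i))))
    ≡⟨ cong₂ ℕ._+_ (𝟙-true (r ℤ.+ + 0 ℤ.≟ r ℤ.+ + 0) refl)
         (sum-tabulate-last n (λ i → 𝟙 (common? (suc i))) (λ i → 𝟙 (interiorMeeting? p q (suc i))) interior end) ⟩
  2 ℕ.+ sum (tabulate (λ i → 𝟙 (interiorMeeting? p q (suc i))))
    -- The term of `intersections` at index 0 computes to 0.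
    ≡⟨ cong (2 ℕ.+_) (sym (trans (length-filter-sum (interiorMeeting? p q) (tabulate {n = suc (suc n)} (λ i → i)))
                                  (cong sum (map-tabulate (λ i → i) (𝟙 ∘ interiorMeeting? p q))))) ⟩
  2 ℕ.+ intersections p q ∎
  where
  open ≡-Reasoning
  common? : ∀ i → Dec (r ℤ.+ abscissa p i ≡ r ℤ.+ abscissa q i)
  common? i = r ℤ.+ abscissa p i ℤ.≟ r ℤ.+ abscissa q i
  interior : ∀ i → toℕ i ℕ.< n → 𝟙 (common? (suc i)) ≡ 𝟙 (interiorMeeting? p q (suc i))
  interior i i<n = 𝟙-cong
    (mk⇔ (λ eq → s≤s z≤n , s≤s i<n , abscissa⇒position p q (suc i) (+-cancelˡ r _ _ eq))
          (λ (_ , _ , eq) → cong (λ x → r ℤ.+ proj₁ x) eq))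
    (common? (suc i)) (interiorMeeting? p q (suc i))
  end : 𝟙 (common? (suc (fromℕ n))) ≡ suc (𝟙 (interiorMeeting? p q (suc (fromℕ n))))
  end = trans (𝟙-true (common? (suc (fromℕ n))) (cong (λ x → r ℤ.+ x) wp≡wq))
    (cong suc (sym (𝟙-false (interiorMeeting? p q (suc (fromℕ n)))
      λ (_ , i<n , _) → ℕₚ.<-irrefl (cong suc (Finₚ.toℕ-fromℕ n)) i<n)))

admissible⇔meeting : ∀ n r k (p q : Path (suc n)) →
  Admissible (suc n) r (+ k) (p , q) ⇔ Meeting (2 ℕ.+ k) r r p q
admissible⇔meeting n r k p q = mk⇔
  (λ (ep , eq , m) → meets (Equivalence.from (width⇔endpoint p r) ep) (Equivalence.from (width⇔endpoint q r) eq) m)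
  (λ (wp , wq , m) →
    Equivalence.to (width⇔endpoint p r) wp , Equivalence.to (width⇔endpoint q r) wq ,
    cong +_ (ℕₚ.suc-injective (ℕₚ.suc-injective
      (trans (sym (arrivals-intersections r p q (trans wp (sym wq)))) m))))
  where
  meets : width p ≡ r → width q ≡ r → + intersections p q ≡ + k → Meeting (2 ℕ.+ k) r r p q
  meets wp wq m = wp , wq ,
    trans (arrivals-intersections r p q (trans wp (sym wq))) (cong (2 ℕ.+_) (ℤₚ.+-injective m))

-- The k interior meetings and the endpoint are k + 1 meetings after the origin: N_k is a
-- coefficient of P^(k+1).
pairCount-walks : ∀ n r k → + pairCount (suc n) r (+ k) ≡ Recurrence.walks (suc n) 0 (suc k) r
pairCount-walks n r k = trans
  (cong +_ (trans (pairCount-Σpair (suc n) r (+ k)) (Σpair-cong (suc n) λ p q →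
    𝟙-cong (admissible⇔meeting n r k p q) (admissible? (suc n) r (+ k) (p , q)) (meeting? (2 ℕ.+ k) r r p q))))
  (meetings-walks (suc n) 0 (suc k) r r (sym (ℤₚ.+-identityʳ r)))

pairCount-negative : ∀ n r → pairCount n r ℤ.-[1+ 0 ] ≡ 0
pairCount-negative n r = trans (pairCount-Σpair n r ℤ.-[1+ 0 ])
  (Σpair-zero n λ p q → 𝟙-false (admissible? n r ℤ.-[1+ 0 ] (p , q)) λ { (_ , _ , ()) })

-- At k = 0 both sides vanish: no pair has -1 intersections, and P^0 = 1 has no term of positive
-- degree.
pairCount-previous : ∀ n r k → + pairCount (suc n) r (+ suc k ℤ.- + 2) ≡ Recurrence.P k (suc n) r
pairCount-previous n r zero    = cong +_ (pairCount-negative (suc n) r)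
pairCount-previous n r (suc k) = pairCount-walks n r k

-- The rational form of the identity.

open import Data.Rational using (_/_; _+_; _*_; toℚᵘ)

-- Since `/` reduces fractions, the equation is moved to unnormalised rationals, where equality is
-- cross-multiplication.
clear-denominators : ∀ k c d u v s t →
  + suc k ℤ.* (c ℤ.* u) ≡ + suc (suc k) ℤ.* (d ℤ.* v) ℤ.+ + suc k ℤ.* + suc (suc k) ℤ.* (s ℤ.+ t) →
  (c / suc (suc k)) * (u / 1) ≡ (d / suc k) * (v / 1) + (s / 1) + (t / 1)
clear-denominators k c d u v s t eq = ℚₚ.toℚᵘ-injective (begin
  toℚᵘ (c / suc (suc k) * (u / 1))
    ≈⟨ ℚₚ.toℚᵘ-homo-* (c / suc (suc k)) (u / 1) ⟩
  toℚᵘ (c / suc (suc k)) ℚᵘ.* toℚᵘ (u / 1)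
    ≈⟨ ℚᵘₚ.*-cong (unreduce c (suc k)) (unreduce u 0) ⟩
  mkℚᵘ c (suc k) ℚᵘ.* mkℚᵘ u 0
    ≈⟨ cleared ⟩
  mkℚᵘ d k ℚᵘ.* mkℚᵘ v 0 ℚᵘ.+ mkℚᵘ s 0 ℚᵘ.+ mkℚᵘ t 0
    ≈⟨ ℚᵘₚ.+-cong (ℚᵘₚ.+-cong (ℚᵘₚ.*-cong (unreduce d k) (unreduce v 0)) (unreduce s 0)) (unreduce t 0) ⟨
  toℚᵘ (d / suc k) ℚᵘ.* toℚᵘ (v / 1) ℚᵘ.+ toℚᵘ (s / 1) ℚᵘ.+ toℚᵘ (t / 1)
    ≈⟨ ℚᵘₚ.+-congˡ (toℚᵘ (t / 1)) (ℚᵘₚ.+-congˡ (toℚᵘ (s / 1)) (ℚₚ.toℚᵘ-homo-* (d / suc k) (v / 1))) ⟨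
  toℚᵘ (d / suc k * (v / 1)) ℚᵘ.+ toℚᵘ (s / 1) ℚᵘ.+ toℚᵘ (t / 1)
    ≈⟨ ℚᵘₚ.+-congˡ (toℚᵘ (t / 1)) (ℚₚ.toℚᵘ-homo-+ (d / suc k * (v / 1)) (s / 1)) ⟨
  toℚᵘ (d / suc k * (v / 1) + s / 1) ℚᵘ.+ toℚᵘ (t / 1)
    ≈⟨ ℚₚ.toℚᵘ-homo-+ (d / suc k * (v / 1) + s / 1) (t / 1) ⟨
  toℚᵘ (d / suc k * (v / 1) + s / 1 + t / 1) ∎)
  where
  open ℚᵘₚ.≃-Reasoning
  unreduce : ∀ i m → toℚᵘ (i / suc m) ℚᵘ.≃ mkℚᵘ i m
  unreduce i m = ℚₚ.toℚᵘ-fromℚᵘ (mkℚᵘ i m)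
  expand : ∀ k c d u v s t →
    (+ 1 ℤ.+ k) ℤ.* (c ℤ.* u) ≡
      (+ 2 ℤ.+ k) ℤ.* (d ℤ.* v) ℤ.+ (+ 1 ℤ.+ k) ℤ.* (+ 2 ℤ.+ k) ℤ.* (s ℤ.+ t) →
    c ℤ.* u ℤ.* (+ 1 ℤ.+ k) ≡
      ((d ℤ.* v ℤ.* + 1 ℤ.+ s ℤ.* (+ 1 ℤ.+ k)) ℤ.* + 1 ℤ.+ t ℤ.* (+ 1 ℤ.+ k)) ℤ.* (+ 2 ℤ.+ k)
  expand k c d u v s t eq = trans (ℤₚ.*-comm (c ℤ.* u) (+ 1 ℤ.+ k)) (trans eq (collect k d v s t))
    where
    collect : ∀ k d v s t →
      (+ 2 ℤ.+ k) ℤ.* (d ℤ.* v) ℤ.+ (+ 1 ℤ.+ k) ℤ.* (+ 2 ℤ.+ k) ℤ.* (s ℤ.+ t) ≡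
        ((d ℤ.* v ℤ.* + 1 ℤ.+ s ℤ.* (+ 1 ℤ.+ k)) ℤ.* + 1 ℤ.+ t ℤ.* (+ 1 ℤ.+ k)) ℤ.* (+ 2 ℤ.+ k)
    collect = solve-∀
  cleared : mkℚᵘ c (suc k) ℚᵘ.* mkℚᵘ u 0 ℚᵘ.≃ mkℚᵘ d k ℚᵘ.* mkℚᵘ v 0 ℚᵘ.+ mkℚᵘ s 0 ℚᵘ.+ mkℚᵘ t 0
  cleared = *≡* numerators
    where
    numerators : ℚᵘ.↥ (mkℚᵘ c (suc k) ℚᵘ.* mkℚᵘ u 0) ℤ.*
        ℚᵘ.↧ (mkℚᵘ d k ℚᵘ.* mkℚᵘ v 0 ℚᵘ.+ mkℚᵘ s 0 ℚᵘ.+ mkℚᵘ t 0)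
      ≡ ℚᵘ.↥ (mkℚᵘ d k ℚᵘ.* mkℚᵘ v 0 ℚᵘ.+ mkℚᵘ s 0 ℚᵘ.+ mkℚᵘ t 0) ℤ.*
        ℚᵘ.↧ (mkℚᵘ c (suc k) ℚᵘ.* mkℚᵘ u 0)
    -- The right-hand denominator carries three nested factors 1; each rewrite removes one layer.
    numerators rewrite ℕₚ.*-identityʳ k | ℕₚ.*-identityʳ k | ℕₚ.*-identityʳ k = expand (+ k) c d u v s t eq

theorem4 : (n k : ℕ) (r : ℤ) → .{{_ : NonZero k}} → 2 ≤ n →
    ((+ n ℤ.- + k ℤ.- + 1) / suc k) * (+ pairCount n r (+ k) / 1)
    ≡ ((+ n ℤ.- + 2 ℤ.* + k) / k) * (+ pairCount n r (+ k ℤ.- + 1) / 1)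
    + (+ pairCount (n ∸ 1) r (+ k ℤ.- + 2) / 1)
    + (+ pairCount (n ∸ 1) (r ℤ.- + 1) (+ k ℤ.- + 2) / 1)
theorem4 (suc (suc n)) (suc k) r (s≤s (s≤s _)) =
  -- As n is at least 2, the lengths n and n - 1 are both positive, as the passage to powers of P
  -- requires.
  clear-denominators k (m ℤ.- κ ℤ.- + 1) (m ℤ.- + 2 ℤ.* κ) N₀ N₁ N₂ N₃ integral
  where
  m κ N₀ N₁ N₂ N₃ : ℤ
  m = + suc (suc n)
  κ = + suc k
  N₀ = + pairCount (suc (suc n)) r κ
  N₁ = + pairCount (suc (suc n)) r (κ ℤ.- + 1)
  N₂ = + pairCount (suc n) r (κ ℤ.- + 2)
  N₃ = + pairCount (suc n) (r ℤ.- + 1) (κ ℤ.- + 2)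
  solve-for : ∀ m κ p q s → κ ℤ.* ((m ℤ.- κ ℤ.- + 1) ℤ.* p) ≡
    (κ ℤ.* (m ℤ.- κ ℤ.- + 1) ℤ.* p ℤ.- (κ ℤ.+ + 1) ℤ.* (m ℤ.- + 2 ℤ.* κ) ℤ.* q ℤ.- κ ℤ.* (κ ℤ.+ + 1) ℤ.* s)
    ℤ.+ ((+ 1 ℤ.+ κ) ℤ.* ((m ℤ.- + 2 ℤ.* κ) ℤ.* q) ℤ.+ κ ℤ.* (+ 1 ℤ.+ κ) ℤ.* s)
  solve-for = solve-∀
  integral : κ ℤ.* ((m ℤ.- κ ℤ.- + 1) ℤ.* N₀) ≡
    + suc (suc k) ℤ.* ((m ℤ.- + 2 ℤ.* κ) ℤ.* N₁) ℤ.+ κ ℤ.* + suc (suc k) ℤ.* (N₂ ℤ.+ N₃)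
  integral = begin
    κ ℤ.* ((m ℤ.- κ ℤ.- + 1) ℤ.* N₀)
      ≡⟨ cong (λ p → κ ℤ.* ((m ℤ.- κ ℤ.- + 1) ℤ.* p)) (pairCount-walks (suc n) r (suc k)) ⟩
    κ ℤ.* ((m ℤ.- κ ℤ.- + 1) ℤ.* p)
      ≡⟨ solve-for m κ p q s ⟩
    relationDefect (suc k) (suc (suc n)) r ℤ.+ rest q s
      ≡⟨ cong (ℤ._+ rest q s) (relationDefect≡0 (suc k) (suc (suc n)) r) ⟩
    + 0 ℤ.+ rest q s
      ≡⟨ ℤₚ.+-identityˡ (rest q s) ⟩
    rest q s
      ≡⟨ cong₂ rest (pairCount-walks (suc n) r k)
           (cong₂ ℤ._+_ (pairCount-previous n r k) (pairCount-previous n (r ℤ.- + 1) k)) ⟨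
    rest N₁ (N₂ ℤ.+ N₃) ∎
    where
    open ≡-Reasoning
    open Recurrence
    p q s : ℤ
    p = P (2 ℕ.+ k) (suc (suc n)) r
    q = P (1 ℕ.+ k) (suc (suc n)) r
    s = w (P k) (suc (suc n)) r
    rest : ℤ → ℤ → ℤ
    rest q s = + suc (suc k) ℤ.* ((m ℤ.- + 2 ℤ.* κ) ℤ.* q) ℤ.+ κ ℤ.* + suc (suc k) ℤ.* s
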